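{- Let $(x_k)_{k\ge0}$ be an arbitrary sequence of numbers (or indeterminates), and define $a_n=x_n$ if $n=2^k-1$ for some integer $k\ge0$ and $a_n=0$ otherwise. Let $d(n)=\det\left(a_{i+j}\right)_{i,j=0}^{n-1}$ with $d(0)=1$, and for $n\ge1$ let $\alpha(n)=2^{\lceil\log_2 n\rceil}-1$ and $\beta(n)=2n-1-\alpha(n)$. Then for all $n\ge1$, $$d(n)=(-1)^{\binom{\beta(n)}{2}}x_{\alpha(n)}^{\beta(n)}\,d(n-\beta(n)).$$ -}

module Defs where

open import Algebra.Bundles using (CommutativeRing)
open import Data.Bool.Base using (if_then_else_)
open import Data.Fin.Base using (Fin; zero; suc; toℕ; punchIn)
open import Data.Nat.Base using (ℕ; zero; suc; _+_; _*_; _∸_; _^_; _<_)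
open import Data.Nat.Logarithm using (⌈log₂_⌉)
open import Data.Nat.Properties
  using (_≟_; anyUpTo?; ≤-refl; ≤-reflexive; ≤-trans; +-mono-≤; +-identityʳ; m^n>0; m∸n+n≡m; +-comm)
open import Data.Product.Base using (∃; _,_)
open import Relation.Binary.PropositionalEquality using (_≡_; refl; sym; trans; cong)
open import Relation.Nullary using (Dec; does)
open import Relation.Nullary.Decidable using (map′)

IsPow2Minus1 : ℕ → Set
IsPow2Minus1 n = ∃ λ k → n ≡ 2 ^ k ∸ 1

private
  k<2^k : ∀ k → k < 2 ^ k
  k<2^k zero    = ≤-refl
  k<2^k (suc k) =
    ≤-trans (+-mono-≤ (m^n>0 2 k) (k<2^k k))
            (≤-reflexive (cong (2 ^ k +_) (sym (+-identityʳ (2 ^ k)))))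

  exponent-bound : ∀ {n} k → n ≡ 2 ^ k ∸ 1 → k < suc n
  exponent-bound k refl =
    ≤-trans (k<2^k k)
            (≤-reflexive (trans (sym (m∸n+n≡m (m^n>0 2 k))) (+-comm (2 ^ k ∸ 1) 1)))

-- If n ≡ 2 ^ k ∸ 1 then k ≤ n, so a bounded search decides the predicate.
isPow2Minus1? : ∀ n → Dec (IsPow2Minus1 n)
isPow2Minus1? n =
  map′ (λ (k , _ , eq) → k , eq)
       (λ (k , eq) → k , exponent-bound k eq , eq)
       (anyUpTo? (λ k → n ≟ 2 ^ k ∸ 1) (suc n))

α : ℕ → ℕ
α n = 2 ^ ⌈log₂ n ⌉ ∸ 1

-- For n ≥ 1 we have n ∸ 1 ≤ α n ≤ 2 * n ∸ 2, so the subtractions defining β,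
-- as well as n ∸ β n, are never truncated, and 1 ≤ β n ≤ n.
β : ℕ → ℕ
β n = 2 * n ∸ 1 ∸ α n

module HankelDeterminant {c ℓ} (R : CommutativeRing c ℓ) where

  open CommutativeRing R
    using (Carrier; 0#; 1#; -_; semiring; +-commutativeMonoid)
    renaming (_*_ to _·_)
  open import Algebra.Properties.Semiring.Exp semiring public
    using () renaming (_^_ to _^ᴿ_)
  open import Algebra.Properties.CommutativeMonoid.Sum +-commutativeMonoid
    using (sum)

  -- Laplace expansion along the first row; the empty determinant is 1#.
  det : ∀ n → (Fin n → Fin n → Carrier) → Carrier
  det zero    M = 1#
  det (suc n) M =
    sum λ j → ((- 1#) ^ᴿ toℕ j) · (M zero j · det n (λ i k → M (suc i) (punchIn j k)))

  a : (ℕ → Carrier) → ℕ → Carrier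
  a x n = if does (isPow2Minus1? n) then x n else 0#

  d : (ℕ → Carrier) → ℕ → Carrier
  d x n = det n (λ i j → a x (toℕ i + toℕ j))

{-# OPTIONS --safe #-}
module Submission where

-- Write P = 2 ^ ⌈log₂ n⌉, m = P ∸ n and b = β n, so n = m + b and P = m + (m + b).
-- In the last b rows and columns, the Hankel matrix has x (α n) on the
-- antidiagonal and zeros below it.  An entry in row i < m and column m + j either
-- vanishes or shares its column with the only nonzero entry of a later row
-- m + r, r = b ∸ 1 ∸ j.  In a Laplace expansion the first m rows therefore use
-- only the first m columns, and the determinant is d m times that of the
-- anti-triangular block.

open import Defs
open import Algebra.Bundles using (CommutativeRing)
open import Data.Nat.Base using (ℕ; _≤_; _∸_)
open import Data.Nat.Combinatorics using (_C_)

open import Data.Bool.Base using (if_then_else_)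
open import Data.Fin.Base
  using (Fin; zero; suc; toℕ; fromℕ; inject₁; opposite; punchIn; punchOut; _↑ˡ_; _↑ʳ_)
open import Data.Fin.Properties
  using (_≟_; toℕ-fromℕ; toℕ-injective; toℕ<n; toℕ-↑ˡ; toℕ-↑ʳ; opposite-prop; fromℕ≢inject₁;
         punchIn-punchOut; punchInᵢ≢i; punchIn-injective)
open import Data.Nat.Base as ℕ using (zero; suc; _<_; s≤s; z≤n; ⌈_/2⌉; ⌊_/2⌋)
open import Data.Nat.Combinatorics using (nCk+nC[k+1]≡[n+1]C[k+1]; nC1≡n)
open import Data.Nat.Induction using (<-wellFounded)
open import Data.Nat.Logarithm
  using (⌈log₂_⌉; ⌈log₂⌉-mono-≤; ⌈log₂2*n⌉≡1+⌈log₂n⌉; ⌈log₂2^n⌉≡n)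
open import Data.Nat.Logarithm.Core using (⌈log2⌉)
open import Data.Nat.Properties as ℕ
  using (≤-refl; ≤-trans; ≤-reflexive; ≤-antisym; ≤-total; <-irrefl; ≰⇒>)
open import Data.Nat.Solver using (module +-*-Solver)
open import Data.Product.Base using (∃; _×_; _,_)
open import Data.Sum.Base using (_⊎_; inj₁; inj₂)
open import Function.Base using (_∘_)
open import Induction.WellFounded using (Acc; acc)
open import Relation.Binary.PropositionalEquality as ≡ using (_≡_; _≢_)
open import Relation.Nullary using (¬_; yes; no)
open import Relation.Nullary.Decidable using (dec-true; dec-false)

-- Powers of two and the ceiling logarithm.

n≤2^⌈log₂n⌉ : ∀ n → n ≤ 2 ℕ.^ ⌈log₂ n ⌉
n≤2^⌈log₂n⌉ n = go n (<-wellFounded n)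
  where
  open ℕ.≤-Reasoning
  -- `⌈log2⌉` recurses on an accessibility proof, passing from `2 + n` to `1 + ⌈ n /2⌉`. The bound
  -- is therefore proved for every such proof, by the same recursion.
  go : ∀ n (rs : Acc _<_ n) → n ≤ 2 ℕ.^ ⌈log2⌉ n rs
  go 0             _        = z≤n
  go 1             _        = ≤-refl
  go (suc (suc n)) (acc rs) = begin
    2 ℕ.+ n                       ≡⟨ ≡.cong (2 ℕ.+_) (ℕ.⌊n/2⌋+⌈n/2⌉≡n n) ⟨
    2 ℕ.+ (⌊ n /2⌋ ℕ.+ ⌈ n /2⌉)   ≤⟨ ℕ.+-monoʳ-≤ 2 (ℕ.+-monoˡ-≤ ⌈ n /2⌉ (ℕ.⌊n/2⌋≤⌈n/2⌉ n)) ⟩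
    2 ℕ.+ (⌈ n /2⌉ ℕ.+ ⌈ n /2⌉)   ≡⟨ solve 1 (λ h → con 2 :+ (h :+ h) := con 2 :* (con 1 :+ h)) ≡.refl ⌈ n /2⌉ ⟩
    2 ℕ.* suc ⌈ n /2⌉             ≤⟨ ℕ.*-monoʳ-≤ 2 (go (suc ⌈ n /2⌉) _) ⟩
    2 ℕ.* 2 ℕ.^ ⌈log2⌉ (suc ⌈ n /2⌉) _ ∎
    where open +-*-Solver

-- Otherwise taking logarithms, which are monotone, would give `1 + ⌈log₂ n ⌉ ≤ ⌈log₂ n ⌉`.
2^⌈log₂n⌉<2*n : ∀ n .{{_ : ℕ.NonZero n}} → 2 ℕ.^ ⌈log₂ n ⌉ < 2 ℕ.* n
2^⌈log₂n⌉<2*n n = ≰⇒> λ 2n≤2^k → <-irrefl ≡.refl (begin-strict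
  ⌈log₂ n ⌉                <⟨ ℕ.n<1+n _ ⟩
  1 ℕ.+ ⌈log₂ n ⌉          ≡⟨ ⌈log₂2*n⌉≡1+⌈log₂n⌉ n ⟨
  ⌈log₂ 2 ℕ.* n ⌉          ≤⟨ ⌈log₂⌉-mono-≤ 2n≤2^k ⟩
  ⌈log₂ 2 ℕ.^ ⌈log₂ n ⌉ ⌉  ≡⟨ ⌈log₂2^n⌉≡n ⌈log₂ n ⌉ ⟩
  ⌈log₂ n ⌉                ∎)
  where open ℕ.≤-Reasoning

2^-cancel-< : ∀ k l → 2 ℕ.^ k < 2 ℕ.^ l → k < l
2^-cancel-< k l 2^k<2^l = ≰⇒> λ l≤k → ℕ.<⇒≱ 2^k<2^l (ℕ.^-monoʳ-≤ 2 l≤k)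

suc[2^n∸1]≡2^n : ∀ n → suc (2 ℕ.^ n ∸ 1) ≡ 2 ℕ.^ n
suc[2^n∸1]≡2^n n = ℕ.m+[n∸m]≡n (ℕ.m^n>0 2 n)

-- If `suc s` were `2 ^ l`, the upper bound would give `l < 1 + k`, and the lower bound, since
-- `1 + 2s < 2 * suc s`, would give `k < 1 + l`. Hence `l ≡ k`, the one case excluded by hypothesis.
¬isPow2Minus1 : ∀ k {s} → suc s ≢ 2 ℕ.^ k → 2 ℕ.^ k ≤ suc (s ℕ.+ s) →
                suc s < 2 ℕ.* 2 ℕ.^ k → ¬ IsPow2Minus1 s
¬isPow2Minus1 k {s} s≢ lower upper (l , s≡) = s≢ (≡.trans 1+s≡2^l (≡.cong (2 ℕ.^_) l≡k))
  where
  open ℕ.≤-Reasoning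
  1+s≡2^l : suc s ≡ 2 ℕ.^ l
  1+s≡2^l = ≡.trans (≡.cong suc s≡) (suc[2^n∸1]≡2^n l)

  l<1+k : l < suc k
  l<1+k = 2^-cancel-< l (suc k) (≡.subst (_< 2 ℕ.^ suc k) 1+s≡2^l upper)

  k<1+l : k < suc l
  k<1+l = 2^-cancel-< k (suc l) (begin-strict
    2 ℕ.^ k        ≤⟨ lower ⟩
    suc (s ℕ.+ s)  <⟨ ≤-reflexive (solve 1 (λ t → con 2 :+ (t :+ t) := con 2 :* (con 1 :+ t)) ≡.refl s) ⟩
    2 ℕ.* suc s    ≡⟨ ≡.cong (2 ℕ.*_) 1+s≡2^l ⟩
    2 ℕ.^ suc l    ∎)
    where open +-*-Solver

  l≡k : l ≡ k
  l≡k = ≤-antisym (ℕ.s≤s⁻¹ l<1+k) (ℕ.s≤s⁻¹ k<1+l)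

-- Sign exponents and index arithmetic in `Fin`.

[1+n]C2≡n+nC2 : ∀ n → suc n C 2 ≡ n ℕ.+ n C 2
[1+n]C2≡n+nC2 n =
  ≡.trans (≡.sym (nCk+nC[k+1]≡[n+1]C[k+1] n 1)) (≡.cong (ℕ._+ n C 2) (nC1≡n n))

toℕ-opposite : ∀ {n} (i : Fin n) → toℕ (opposite i) ℕ.+ suc (toℕ i) ≡ n
toℕ-opposite {n} i =
  ≡.trans (≡.cong (ℕ._+ suc (toℕ i)) (opposite-prop i)) (ℕ.m∸n+n≡m (toℕ<n i))

punchIn-↑ˡ-↑ˡ : ∀ {m} b (i : Fin (suc m)) (j : Fin m) →
                punchIn (i ↑ˡ b) (j ↑ˡ b) ≡ punchIn i j ↑ˡ b
punchIn-↑ˡ-↑ˡ b zero    j       = ≡.refl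
punchIn-↑ˡ-↑ˡ b (suc i) zero    = ≡.refl
punchIn-↑ˡ-↑ˡ b (suc i) (suc j) = ≡.cong suc (punchIn-↑ˡ-↑ˡ b i j)

punchIn-↑ˡ-↑ʳ : ∀ {m b} (i : Fin (suc m)) (j : Fin b) →
                punchIn (i ↑ˡ b) (m ↑ʳ j) ≡ suc m ↑ʳ j
punchIn-↑ˡ-↑ʳ         zero    j = ≡.refl
punchIn-↑ˡ-↑ʳ {suc m} (suc i) j = ≡.cong suc (punchIn-↑ˡ-↑ʳ i j)

toℕ-punchIn-fromℕ : ∀ {n} (i : Fin n) → toℕ (punchIn (fromℕ n) i) ≡ toℕ i
toℕ-punchIn-fromℕ zero    = ≡.refl
toℕ-punchIn-fromℕ (suc i) = ≡.cong suc (toℕ-punchIn-fromℕ i)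

module _ {c ℓ} (R : CommutativeRing c ℓ) where

  open CommutativeRing R hiding (zero)
  open HankelDeterminant R
  open import Algebra.Properties.CommutativeMonoid.Sum +-commutativeMonoid
    using (sum; sum-cong-≋; sum-replicate-zero; sum-init-last)
  open import Algebra.Properties.Semiring.Sum semiring using (*-distribʳ-sum)
  open import Algebra.Properties.Semiring.Exp semiring using (^-homo-*; ^-congʳ)
  open import Algebra.Properties.CommutativeSemigroup *-commutativeSemigroup
    using (x∙yz≈y∙xz)
  open import Relation.Binary.Reasoning.Setoid setoid

  -- Determinants by expansion along the first row.

  Matrix : ℕ → Set c
  Matrix n = Fin n → Fin n → Carrier

  minor : ∀ {n} → Matrix (suc n) → Fin (suc n) → Matrix n
  minor M j i k = M (suc i) (punchIn j k)

  laplaceTerm : ∀ {n} → Matrix (suc n) → Fin (suc n) → Carrier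
  laplaceTerm {n} M j = ((- 1#) ^ᴿ toℕ j) * (M zero j * det n (minor M j))

  sum-zero : ∀ {n} (f : Fin n → Carrier) → (∀ i → f i ≈ 0#) → sum f ≈ 0#
  sum-zero {n} f f≈0 = trans (sum-cong-≋ f≈0) (sum-replicate-zero n)

  sum-↑ : ∀ m {b} (f : Fin (m ℕ.+ b) → Carrier) →
          sum f ≈ sum (λ i → f (i ↑ˡ b)) + sum (λ j → f (m ↑ʳ j))
  sum-↑ zero    f = sym (+-identityˡ _)
  sum-↑ (suc m) f = trans (+-congˡ (sum-↑ m (f ∘ suc))) (sym (+-assoc _ _ _))

  term-zeroˡ : ∀ s {y} z → y ≈ 0# → s * (y * z) ≈ 0#
  term-zeroˡ s z y≈0 = trans (*-congˡ (trans (*-congʳ y≈0) (zeroˡ z))) (zeroʳ s)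

  term-zeroʳ : ∀ s y {z} → z ≈ 0# → s * (y * z) ≈ 0#
  term-zeroʳ s y z≈0 = trans (*-congˡ (trans (*-congˡ z≈0) (zeroʳ y))) (zeroʳ s)

  det-cong : ∀ n {M N : Matrix n} → (∀ i j → M i j ≈ N i j) → det n M ≈ det n N
  det-cong zero    M≈N = refl
  det-cong (suc n) M≈N = sum-cong-≋ λ j →
    *-congˡ {(- 1#) ^ᴿ toℕ j} (*-cong (M≈N zero j) (det-cong n λ i k → M≈N (suc i) (punchIn j k)))

  det-zeroRow : ∀ {n} (M : Matrix n) r → (∀ j → M r j ≈ 0#) → det n M ≈ 0#
  det-zeroRow M zero    row≈0 = sum-zero (laplaceTerm M) λ j → term-zeroˡ _ _ (row≈0 j)
  det-zeroRow {suc (suc n)} M (suc r) row≈0 = sum-zero (laplaceTerm M) λ j →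
    term-zeroʳ _ _ (det-zeroRow (minor M j) r (row≈0 ∘ punchIn j))

  det-zeroColumn : ∀ {n} (M : Matrix n) c → (∀ i → M i c ≈ 0#) → det n M ≈ 0#
  det-zeroColumn {suc n} M c col≈0 = sum-zero (laplaceTerm M) term≈0
    where
    term≈0 : ∀ j → laplaceTerm M j ≈ 0#
    term≈0 j with j ≟ c
    ... | yes ≡.refl = term-zeroˡ _ _ (col≈0 zero)
    -- Deleting another column keeps column `c`, now at position `punchOut j≢c` of the minor.
    ... | no  j≢c    = term-zeroʳ _ _ (det-zeroColumn (minor M j) (punchOut j≢c) λ i →
      trans (reflexive (≡.cong (M (suc i)) (punchIn-punchOut j≢c))) (col≈0 (suc i)))

  -- Expanding along an early row at column m ↑ʳ j gives 0: either the entry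
  -- vanishes or removing the column leaves a zero row in the minor.
  det-block : ∀ m {b} (M : Matrix (m ℕ.+ b)) →
    (∀ (i : Fin m) (j : Fin b) → M (i ↑ˡ b) (m ↑ʳ j) ≈ 0#
      ⊎ ∃ λ (r : Fin b) → ∀ c → c ≢ m ↑ʳ j → M (m ↑ʳ r) c ≈ 0#) →
    det (m ℕ.+ b) M ≈ det m (λ i j → M (i ↑ˡ b) (j ↑ˡ b)) * det b (λ i j → M (m ↑ʳ i) (m ↑ʳ j))
  det-block zero    M _ = sym (*-identityˡ _)
  det-block (suc m) {b} M h = begin
    sum (laplaceTerm M)                             ≈⟨ sum-↑ (suc m) (laplaceTerm M) ⟩
    sum (λ j → laplaceTerm M (j ↑ˡ b)) + sum (λ j → laplaceTerm M (suc m ↑ʳ j))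
                                                    ≈⟨ +-cong (sum-cong-≋ termˡ) (sum-zero _ termʳ) ⟩
    sum (λ j → laplaceTerm A j * det b B) + 0#      ≈⟨ +-identityʳ _ ⟩
    sum (λ j → laplaceTerm A j * det b B)           ≈⟨ *-distribʳ-sum (det b B) (laplaceTerm A) ⟨
    sum (laplaceTerm A) * det b B                   ∎
    where
    A : Matrix (suc m)
    A i j = M (i ↑ˡ b) (j ↑ˡ b)

    B : Matrix b
    B i j = M (suc m ↑ʳ i) (suc m ↑ʳ j)

    -- The hypothesis survives deletion of the first row and an early column: late columns keep
    -- their order and are only shifted by one. Injectivity of `punchIn` carries the condition
    -- `c ≢ m ↑ʳ j` back to `M`.
    minor-h : ∀ k (i : Fin m) (j : Fin b) → minor M (k ↑ˡ b) (i ↑ˡ b) (m ↑ʳ j) ≈ 0#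
      ⊎ ∃ λ (r : Fin b) → ∀ c → c ≢ m ↑ʳ j → minor M (k ↑ˡ b) (m ↑ʳ r) c ≈ 0#
    minor-h k i j with h (suc i) j
    ... | inj₁ entry≈0 =
      inj₁ (trans (reflexive (≡.cong (M (suc i ↑ˡ b)) (punchIn-↑ˡ-↑ʳ k j))) entry≈0)
    ... | inj₂ (r , row≈0) = inj₂ (r , λ c c≢ → row≈0 (punchIn (k ↑ˡ b) c) λ eq →
      c≢ (punchIn-injective (k ↑ˡ b) c (m ↑ʳ j) (≡.trans eq (≡.sym (punchIn-↑ˡ-↑ʳ k j)))))

    minor-det : ∀ k → det (m ℕ.+ b) (minor M (k ↑ˡ b)) ≈ det m (minor A k) * det b B
    minor-det k = trans (det-block m (minor M (k ↑ˡ b)) (minor-h k)) (*-cong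
      (det-cong m λ i j → reflexive (≡.cong (M (suc i ↑ˡ b)) (punchIn-↑ˡ-↑ˡ b k j)))
      (det-cong b λ i j → reflexive (≡.cong (M (suc m ↑ʳ i)) (punchIn-↑ˡ-↑ʳ k j))))

    termˡ : ∀ j → laplaceTerm M (j ↑ˡ b) ≈ laplaceTerm A j * det b B
    termˡ j = begin
      ((- 1#) ^ᴿ toℕ (j ↑ˡ b)) * (A zero j * det (m ℕ.+ b) (minor M (j ↑ˡ b)))
        ≈⟨ *-cong (^-congʳ (- 1#) (toℕ-↑ˡ j b)) (*-congˡ (minor-det j)) ⟩
      ((- 1#) ^ᴿ toℕ j) * (A zero j * (det m (minor A j) * det b B))
        ≈⟨ *-congˡ (*-assoc _ _ _) ⟨
      ((- 1#) ^ᴿ toℕ j) * (A zero j * det m (minor A j) * det b B)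
        ≈⟨ *-assoc _ _ _ ⟨
      laplaceTerm A j * det b B ∎

    termʳ : ∀ j → laplaceTerm M (suc m ↑ʳ j) ≈ 0#
    termʳ j with h zero j
    ... | inj₁ entry≈0 = term-zeroˡ _ _ entry≈0
    ... | inj₂ (r , row≈0) = term-zeroʳ _ _
      (det-zeroRow (minor M (suc m ↑ʳ j)) (m ↑ʳ r) λ k → row≈0 _ (punchInᵢ≢i (suc m ↑ʳ j) k))

  -- In the first row only the last column contributes: for any other choice the minor retains the
  -- last column of `M`, which is zero below the first row. The remaining minor is again
  -- anti-triangular, and the signs `(-1)^b` accumulate to the binomial exponent. Entries above the
  -- antidiagonal may be arbitrary.
  det-antiTriangular : ∀ b (M : Matrix b) y →
    (∀ i j → suc (toℕ i ℕ.+ toℕ j) ≡ b → M i j ≈ y) →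
    (∀ i j → b ≤ toℕ i ℕ.+ toℕ j → M i j ≈ 0#) →
    det b M ≈ ((- 1#) ^ᴿ (b C 2)) * (y ^ᴿ b)
  det-antiTriangular zero    M y _    _     = sym (*-identityˡ 1#)
  det-antiTriangular (suc b) M y diag below = begin
    sum (laplaceTerm M)
      ≈⟨ sum-init-last (laplaceTerm M) ⟩
    sum (laplaceTerm M ∘ inject₁) + laplaceTerm M (fromℕ b)
      ≈⟨ +-congʳ (sum-zero (laplaceTerm M ∘ inject₁) initTerm) ⟩
    0# + laplaceTerm M (fromℕ b)
      ≈⟨ +-identityˡ _ ⟩
    ((- 1#) ^ᴿ toℕ (fromℕ b)) * (M zero (fromℕ b) * det b (minor M (fromℕ b)))
      ≈⟨ *-cong (^-congʳ (- 1#) (toℕ-fromℕ b))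
                (*-cong (diag zero (fromℕ b) (≡.cong suc (toℕ-fromℕ b))) lastMinor) ⟩
    ((- 1#) ^ᴿ b) * (y * (((- 1#) ^ᴿ (b C 2)) * (y ^ᴿ b)))
      ≈⟨ *-congˡ (x∙yz≈y∙xz _ _ _) ⟩
    ((- 1#) ^ᴿ b) * (((- 1#) ^ᴿ (b C 2)) * (y * (y ^ᴿ b)))
      ≈⟨ *-assoc _ _ _ ⟨
    ((- 1#) ^ᴿ b) * ((- 1#) ^ᴿ (b C 2)) * (y * (y ^ᴿ b))
      ≈⟨ *-congʳ (^-homo-* (- 1#) b (b C 2)) ⟨
    ((- 1#) ^ᴿ (b ℕ.+ b C 2)) * (y ^ᴿ suc b)
      ≈⟨ *-congʳ (^-congʳ (- 1#) ([1+n]C2≡n+nC2 b)) ⟨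
    ((- 1#) ^ᴿ (suc b C 2)) * (y ^ᴿ suc b) ∎
    where
    initTerm : ∀ j → laplaceTerm M (inject₁ j) ≈ 0#
    initTerm j = term-zeroʳ _ _ (det-zeroColumn (minor M (inject₁ j)) (punchOut j≢last) λ i →
      trans (reflexive (≡.cong (M (suc i)) (punchIn-punchOut j≢last)))
            (below (suc i) (fromℕ b) (s≤s (≤-trans (≤-reflexive (≡.sym (toℕ-fromℕ b)))
                                                   (ℕ.m≤n+m _ (toℕ i))))))
      where
      j≢last : inject₁ j ≢ fromℕ b
      j≢last = fromℕ≢inject₁ ∘ ≡.sym

    shift : ∀ (i j : Fin b) →
      suc (toℕ i) ℕ.+ toℕ (punchIn (fromℕ b) j) ≡ suc (toℕ i ℕ.+ toℕ j)
    shift i j = ≡.cong (suc (toℕ i) ℕ.+_) (toℕ-punchIn-fromℕ j)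

    lastMinor : det b (minor M (fromℕ b)) ≈ ((- 1#) ^ᴿ (b C 2)) * (y ^ᴿ b)
    lastMinor = det-antiTriangular b (minor M (fromℕ b)) y
      (λ i j eq → diag (suc i) _ (≡.cong suc (≡.trans (shift i j) eq)))
      (λ i j le → below (suc i) _ (≤-trans (s≤s le) (≤-reflexive (≡.sym (shift i j)))))

  -- Entries and block structure of the Hankel matrix.

  a-value : ∀ x {s} → IsPow2Minus1 s → a x s ≡ x s
  a-value x {s} p = ≡.cong (λ c → if c then x s else 0#) (dec-true (isPow2Minus1? s) p)

  a-vanishes : ∀ x {s} → ¬ IsPow2Minus1 s → a x s ≡ 0#
  a-vanishes x {s} ¬p = ≡.cong (λ c → if c then x s else 0#) (dec-false (isPow2Minus1? s) ¬p)

  -- Writing the size as `m + b` lets `↑ˡ` and `↑ʳ` cut out the blocks. Position `(m + i, m + j)`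
  -- carries the index `2m + i + j`, which is `2 ^ k ∸ 1` exactly when `i + j + 1 = b`, so the lower
  -- right block is anti-triangular.
  d-split : ∀ x k m b → m ℕ.+ (m ℕ.+ b) ≡ 2 ℕ.^ k →
    d x (m ℕ.+ b) ≈ ((- 1#) ^ᴿ (b C 2)) * ((x (2 ℕ.^ k ∸ 1) ^ᴿ b) * d x m)
  d-split x k m b m+m+b≡2^k = begin
    det (m ℕ.+ b) H
      ≈⟨ det-block m H block ⟩
    det m (λ i j → H (i ↑ˡ b) (j ↑ˡ b)) * det b (λ i j → H (m ↑ʳ i) (m ↑ʳ j))
      ≈⟨ *-cong topLeft (det-antiTriangular b _ y diag below) ⟩
    d x m * (((- 1#) ^ᴿ (b C 2)) * (y ^ᴿ b))
      ≈⟨ *-comm _ _ ⟩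
    ((- 1#) ^ᴿ (b C 2)) * (y ^ᴿ b) * d x m
      ≈⟨ *-assoc _ _ _ ⟩
    ((- 1#) ^ᴿ (b C 2)) * ((y ^ᴿ b) * d x m) ∎
    where
    open +-*-Solver using (solve; _:+_; _:*_; _:=_; con)
    module ≤R = ℕ.≤-Reasoning

    H : Matrix (m ℕ.+ b)
    H i j = a x (toℕ i ℕ.+ toℕ j)

    y : Carrier
    y = x (2 ℕ.^ k ∸ 1)

    -- Row and column numbers are below `2 ^ k`, which supplies the upper bound in `¬isPow2Minus1`.
    -- The sum has its own name `s` so that it can be given in whatever form is convenient.
    H-vanishes : ∀ i j {s} → toℕ i ℕ.+ toℕ j ≡ s → suc s ≢ 2 ℕ.^ k →
                 2 ℕ.^ k ≤ suc (s ℕ.+ s) → H i j ≈ 0#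
    H-vanishes i j ≡.refl s≢ lower =
      reflexive (a-vanishes x (¬isPow2Minus1 k s≢ lower (≤R.begin
        2 ℕ.+ (toℕ i ℕ.+ toℕ j)
          ≤R.≡⟨ solve 2 (λ p q → con 2 :+ (p :+ q) := (con 1 :+ p) :+ (con 1 :+ q)) ≡.refl (toℕ i) (toℕ j) ⟩
        suc (toℕ i) ℕ.+ suc (toℕ j)
          ≤R.≤⟨ ℕ.+-mono-≤ (<2^k i) (<2^k j) ⟩
        2 ℕ.^ k ℕ.+ 2 ℕ.^ k
          ≤R.≡⟨ solve 1 (λ p → p :+ p := con 2 :* p) ≡.refl (2 ℕ.^ k) ⟩
        2 ℕ.* 2 ℕ.^ k ≤R.∎)))
      where
      <2^k : ∀ (i : Fin (m ℕ.+ b)) → toℕ i < 2 ℕ.^ k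
      <2^k i = ≤-trans (toℕ<n i) (≤-trans (ℕ.m≤n+m _ m) (≤-reflexive m+m+b≡2^k))

    antidiagonal : ∀ (j : Fin b) →
      suc ((m ℕ.+ toℕ (opposite j)) ℕ.+ (m ℕ.+ toℕ j)) ≡ 2 ℕ.^ k
    antidiagonal j = ≡.trans
      (solve 3 (λ p q r → con 1 :+ ((p :+ r) :+ (p :+ q)) := p :+ (p :+ (r :+ (con 1 :+ q))))
        ≡.refl m (toℕ j) (toℕ (opposite j)))
      (≡.trans (≡.cong (λ t → m ℕ.+ (m ℕ.+ t)) (toℕ-opposite j)) m+m+b≡2^k)

    block : ∀ (i : Fin m) (j : Fin b) → H (i ↑ˡ b) (m ↑ʳ j) ≈ 0#
      ⊎ ∃ λ (r : Fin b) → ∀ c → c ≢ m ↑ʳ j → H (m ↑ʳ r) c ≈ 0#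
    block i j with ≤-total (toℕ j) (toℕ (opposite j))
    -- Put `r = opposite j`. Every index `s` in row `m + r` is at least `m + r ≥ m + j`, so
    -- `2s + 1 ≥ 2 ^ k` by `antidiagonal`. Only `s = 2 ^ k ∸ 1` can then be nonzero, and this occurs
    -- in column `m + j` alone.
    ... | inj₁ j≤r = inj₂ (opposite j , λ c c≢ →
      H-vanishes (m ↑ʳ opposite j) c (≡.cong (ℕ._+ toℕ c) (toℕ-↑ʳ m (opposite j)))
        (λ eq → c≢ (toℕ-injective (≡.trans
          (ℕ.+-cancelˡ-≡ (m ℕ.+ toℕ (opposite j)) _ _
            (ℕ.suc-injective (≡.trans eq (≡.sym (antidiagonal j)))))
          (≡.sym (toℕ-↑ʳ m j)))))
        (≤-trans (≤-reflexive (≡.sym (antidiagonal j)))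
          (s≤s (ℕ.+-mono-≤ (ℕ.m≤m+n (m ℕ.+ toℕ (opposite j)) (toℕ c))
                           (≤-trans (ℕ.+-monoʳ-≤ m j≤r) (ℕ.m≤m+n _ (toℕ c)))))))
    -- Here the entry itself vanishes: its index `s = i + (m + j)` is below `2 ^ k ∸ 1` because
    -- `i < m ≤ m + r`, while `s ≥ m + j ≥ m + r` again yields `2s + 1 ≥ 2 ^ k`.
    ... | inj₂ r≤j = inj₁ (
      H-vanishes (i ↑ˡ b) (m ↑ʳ j) (≡.cong₂ ℕ._+_ (toℕ-↑ˡ i b) (toℕ-↑ʳ m j))
        (ℕ.<⇒≢ (≤-trans (s≤s (ℕ.+-monoˡ-≤ (m ℕ.+ toℕ j) (≤-trans (toℕ<n i) (ℕ.m≤m+n m _))))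
                        (≤-reflexive (antidiagonal j))))
        (≤-trans (≤-reflexive (≡.sym (antidiagonal j)))
          (s≤s (ℕ.+-mono-≤ (≤-trans (ℕ.+-monoʳ-≤ m r≤j) (ℕ.m≤n+m _ (toℕ i)))
                           (ℕ.m≤n+m _ (toℕ i))))))

    topLeft : det m (λ i j → H (i ↑ˡ b) (j ↑ˡ b)) ≈ d x m
    topLeft = det-cong m λ i j →
      reflexive (≡.cong₂ (λ p q → a x (p ℕ.+ q)) (toℕ-↑ˡ i b) (toℕ-↑ˡ j b))

    blockIndex : ∀ (i j : Fin b) →
      toℕ (m ↑ʳ i) ℕ.+ toℕ (m ↑ʳ j) ≡ m ℕ.+ (m ℕ.+ (toℕ i ℕ.+ toℕ j))
    blockIndex i j = ≡.trans (≡.cong₂ ℕ._+_ (toℕ-↑ʳ m i) (toℕ-↑ʳ m j))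
      (solve 3 (λ p q r → (p :+ q) :+ (p :+ r) := p :+ (p :+ (q :+ r))) ≡.refl m (toℕ i) (toℕ j))

    diag : ∀ i j → suc (toℕ i ℕ.+ toℕ j) ≡ b → H (m ↑ʳ i) (m ↑ʳ j) ≈ y
    diag i j eq = reflexive (≡.trans (≡.cong (a x) index) (a-value x (k , ≡.refl)))
      where
      index : toℕ (m ↑ʳ i) ℕ.+ toℕ (m ↑ʳ j) ≡ 2 ℕ.^ k ∸ 1
      index = ≡.trans (blockIndex i j) (≡.cong (_∸ 1) (≡.trans
        (solve 2 (λ p q → con 1 :+ (p :+ (p :+ q)) := p :+ (p :+ (con 1 :+ q)))
          ≡.refl m (toℕ i ℕ.+ toℕ j))
        (≡.trans (≡.cong (λ t → m ℕ.+ (m ℕ.+ t)) eq) m+m+b≡2^k)))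

    below : ∀ i j → b ≤ toℕ i ℕ.+ toℕ j → H (m ↑ʳ i) (m ↑ʳ j) ≈ 0#
    -- These indices lie strictly between `2 ^ k ∸ 1` and `2 ^ (k + 1) ∸ 1`.
    below i j b≤i+j = H-vanishes (m ↑ʳ i) (m ↑ʳ j) (blockIndex i j)
      (λ eq → ℕ.<⇒≢ (s≤s 2^k≤s) (≡.sym eq))
      (ℕ.m≤n⇒m≤1+n (≤-trans 2^k≤s (ℕ.m≤m+n _ _)))
      where
      2^k≤s : 2 ℕ.^ k ≤ m ℕ.+ (m ℕ.+ (toℕ i ℕ.+ toℕ j))
      2^k≤s = ≤-trans (≤-reflexive (≡.sym m+m+b≡2^k))
                      (ℕ.+-monoʳ-≤ m (ℕ.+-monoʳ-≤ m b≤i+j))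

-- Arithmetic of `α` and `β`, and the recurrence.

-- The witness is `P ∸ n`. The subtractions of `1` and `α n = P ∸ 1` in `β n` merge into
-- `2 * n ∸ P`, and the bounds `n ≤ P < 2 * n` ensure that nothing is truncated.
αβ-split : ∀ n → 1 ≤ n → ∃ λ m → m ℕ.+ β n ≡ n × m ℕ.+ (m ℕ.+ β n) ≡ 2 ℕ.^ ⌈log₂ n ⌉
αβ-split n 1≤n = P ∸ n , m+β≡n , ≡.trans (≡.cong (P ∸ n ℕ.+_) m+β≡n) (ℕ.m∸n+n≡m n≤P)
  where
  instance
    n≢0 : ℕ.NonZero n
    n≢0 = ℕ.>-nonZero 1≤n

  P : ℕ
  P = 2 ℕ.^ ⌈log₂ n ⌉

  n≤P : n ≤ P
  n≤P = n≤2^⌈log₂n⌉ n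

  β≡2n∸P : β n ≡ 2 ℕ.* n ∸ P
  β≡2n∸P = ≡.trans (ℕ.∸-+-assoc (2 ℕ.* n) 1 (P ∸ 1))
                   (≡.cong (2 ℕ.* n ∸_) (suc[2^n∸1]≡2^n ⌈log₂ n ⌉))

  m+β≡n : P ∸ n ℕ.+ β n ≡ n
  m+β≡n = ℕ.+-cancelʳ-≡ n _ _ (begin
    P ∸ n ℕ.+ β n ℕ.+ n              ≡⟨ ≡.cong (λ t → P ∸ n ℕ.+ t ℕ.+ n) β≡2n∸P ⟩
    P ∸ n ℕ.+ (2 ℕ.* n ∸ P) ℕ.+ n    ≡⟨ solve 3 (λ p q r → p :+ q :+ r := q :+ (p :+ r)) ≡.refl (P ∸ n) (2 ℕ.* n ∸ P) n ⟩
    2 ℕ.* n ∸ P ℕ.+ (P ∸ n ℕ.+ n)    ≡⟨ ≡.cong (2 ℕ.* n ∸ P ℕ.+_) (ℕ.m∸n+n≡m n≤P) ⟩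
    2 ℕ.* n ∸ P ℕ.+ P                ≡⟨ ℕ.m∸n+n≡m (ℕ.<⇒≤ (2^⌈log₂n⌉<2*n n)) ⟩
    2 ℕ.* n                          ≡⟨ solve 1 (λ r → con 2 :* r := r :+ r) ≡.refl n ⟩
    n ℕ.+ n                          ∎)
    where
    open ≡.≡-Reasoning
    open +-*-Solver

theorem4p1 : ∀ {c ℓ} (R : CommutativeRing c ℓ) →
    let open CommutativeRing R
        open HankelDeterminant R in
    (x : ℕ → Carrier) (n : ℕ) → 1 ≤ n →
    d x n ≈ ((- 1#) ^ᴿ (β n C 2)) * ((x (α n) ^ᴿ β n) * d x (n ∸ β n))
theorem4p1 R x n 1≤n with αβ-split n 1≤n
-- Transport turns the size `m + β n` into `n`, and the smaller size `m = (m + β n) ∸ β n` into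
-- `n ∸ β n`.
... | m , m+β≡n , m+m+β≡P = ≡.subst₂
  (λ p q → d x p ≈ ((- 1#) ^ᴿ (β n C 2)) * ((x (α n) ^ᴿ β n) * d x q))
  m+β≡n
  (≡.trans (≡.sym (ℕ.m+n∸n≡m m (β n))) (≡.cong (_∸ β n) m+β≡n))
  (d-split R x ⌈log₂ n ⌉ m (β n) m+m+β≡P)
  where
  open CommutativeRing R hiding (zero)
  open HankelDeterminant R
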